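{- For any integer $k\geq 1$, every strongly $k$-connected tournament $T$ on $n$ vertices contains a strongly $k$-connected spanning subgraph $D$ with $|E(D)|\leq (5k-2)n + \binom{5k}{2}$.
   Context: A tournament is an orientation of a complete simple graph. A digraph $D$ is strongly connected if for any two vertices $u,v$ there is a directed path from $u$ to $v$. A digraph $D$ is strongly $k$-connected if $|V(D)| \geq k+1$ and for every set $S \subseteq V(D)$ with $|S| \leq k-1$, the digraph $D - S$ is strongly connected. $E(D)$ is the arc set of $D$. -}

module Defs where

open import Data.Fin.Base using (Fin)
open import Data.Fin.Subset using (Subset; _∈_; ∁; ∣_∣)
open import Data.List.Base using (List; allFin; cartesianProduct; filter)
open import Data.Nat.Base using (ℕ; suc; _≤_; _<_)
open import Data.Product.Base using (Σ-syntax; _×_; proj₁; uncurry)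
open import Function.Base using (_on_)
open import Level using (0ℓ)
open import Relation.Binary.Construct.Closure.ReflexiveTransitive using (Star)
open import Relation.Binary.Core using (Rel; _⇒_)
open import Relation.Binary.Definitions using (Decidable; Trichotomous)
open import Relation.Binary.PropositionalEquality.Core using (_≡_)
open import Relation.Nullary.Negation.Core using (¬_)

-- Finite digraphs without loops or parallel arcs; a pair of opposite arcs
-- is allowed.  Decidability of `Arc` makes the arc set a finite set.
record Digraph (n : ℕ) : Set₁ where
  field
    Arc      : Rel (Fin n) 0ℓ
    arc?     : Decidable Arc
    loopless : ∀ v → ¬ Arc v v

open Digraph public

-- Every ordered pair occurs exactly once in the cartesian product, so
-- `length (E D)` is the number of arcs.
E : ∀ {n} → Digraph n → List (Fin n × Fin n)
E {n} D = filter (λ e → uncurry (arc? D) e) (cartesianProduct (allFin n) (allFin n))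

-- Exactly one of `Arc u v`, `u ≡ v`, `Arc v u` holds.
IsTournament : ∀ {n} → Digraph n → Set
IsTournament D = Trichotomous _≡_ (Arc D)

-- The inhabitants of `Star R u v` are the directed walks from u to v
-- (possibly of length 0); one exists if and only if a directed path does.
StronglyConnected : {V : Set} → Rel V 0ℓ → Set
StronglyConnected R = ∀ u v → Star R u v

-- `v ∈ ∁ S` is used rather than `v ∉ S` because its proofs are unique, so
-- that each vertex outside S is counted only once.
Remaining : ∀ {n} → Subset n → Set
Remaining {n} S = Σ[ v ∈ Fin n ] v ∈ ∁ S

-- The arcs of D − S.
_∖_ : ∀ {n} → Digraph n → (S : Subset n) → Rel (Remaining S) 0ℓ
D ∖ S = Arc D on proj₁

-- The bound `∣ S ∣ < k` is |S| ≤ k − 1 without truncated subtraction.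
Strongly_-connected : ℕ → ∀ {n} → Digraph n → Set
Strongly_-connected k {n} D =
  suc k ≤ n × (∀ (S : Subset n) → ∣ S ∣ < k → StronglyConnected (D ∖ S))

-- Both digraphs have vertex set Fin n, so containment of arcs suffices.
_IsSpanningSubgraphOf_ : ∀ {n} → Digraph n → Digraph n → Set
D IsSpanningSubgraphOf T = Arc D ⇒ Arc T

{-# OPTIONS --safe #-}

-- Write k = j + 1.  Let U be a set of 7j + 1 vertices.  Repeatedly taking out of U a vertex of
-- maximal outdegree gives a set A ⊆ U of k vertices, each of which, after the deletion of a set S of
-- at most j vertices, still reaches inside U all but 3j vertices of U ∖ S; dually there is a set
-- B ⊆ U of k vertices, each of which is reached from all but 3j vertices.  As |U ∖ S| > 6j, every
-- vertex of A ∖ S reaches every vertex of B ∖ S within U.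
-- It remains to link B to all vertices, and all vertices to A, robustly under the deletion of S.  An
-- inclusion-minimal subgraph linking B to all vertices has indegrees at most k, since the tight
-- separations for a vertex are closed under intersection by submodularity; the same holds for
-- outdegrees and A.  This gives at most 2kn + C(7j + 1, 2) arcs.  For n ≤ 7j the whole
-- tournament is sparse enough.

module Submission where

open import Defs
open import Data.List.Base using (length)
open import Data.Nat.Base using (ℕ; _+_; _*_; _∸_; _≤_)
open import Data.Nat.Combinatorics using (_C_)
open import Data.Product.Base using (Σ-syntax; _×_)

open import Data.Bool.Base using (Bool; true; false; T; not; _∧_; _∨_; if_then_else_)
open import Data.Bool.Properties using (T?; T-∧; T-∨; T-≡; ∨-∧-booleanAlgebra)
open import Data.Empty using (⊥-elim)
open import Data.Fin.Base using (Fin; zero; suc; toℕ)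
open import Data.Fin.Properties using (_≟_; any?; all?)
open import Data.Fin.Subset using (Subset; ∣_∣; ∁) renaming (_∈_ to _∈ˢ_)
open import Data.Fin.Subset.Properties using (anySubset?; x∉p⇒x∈∁p; x∈∁p⇒x∉p)
open import Data.List.Base as List using ([]; _∷_; allFin; cartesianProduct; filter)
open import Data.List.Membership.Propositional using (_∈_)
open import Data.List.Membership.Propositional.Properties using (∈-allFin)
open import Data.List.Properties using (length-++; filter-++)
open import Data.List.Relation.Unary.Any using (here; there)
open import Data.Nat.Base using (zero; suc; _<_; _<ᵇ_; z≤n; s≤s; s≤s⁻¹)
open import Data.Nat.Combinatorics using (nCk+nC[k+1]≡[n+1]C[k+1]; nC1≡n)
open import Data.Nat.Properties hiding (_≟_)
open import Data.Nat.Solver using (module +-*-Solver)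
open import Data.Product.Base using (∃; ∃₂; _,_; proj₁; proj₂; uncurry)
open import Data.Sum.Base using (_⊎_; inj₁; inj₂; [_,_]; swap)
open import Data.Unit.Base using (tt)
open import Data.Vec.Base as Vec using ([]; _∷_)
open import Data.Vec.Properties using (lookup∘tabulate; []=⇒lookup; lookup⇒[]=)
open import Data.Vec.Properties.WithK using ([]=-irrelevant)
open import Function.Base using (_∘_; id; flip; const)
open import Function.Bundles using (Equivalence)
open import Relation.Binary.Construct.Closure.ReflexiveTransitive using (Star; ε; _◅_; _◅◅_)
open import Relation.Binary.Definitions using (tri<; tri≈; tri>)
open import Relation.Binary.PropositionalEquality
  using (_≡_; _≢_; refl; sym; trans; cong; cong₂; subst; _≗_; module ≡-Reasoning)
open import Relation.Nullary using (¬_; Dec; yes; no; does)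
open import Relation.Nullary.Decidable using (_×-dec_; _→-dec_; ¬?)
open import Relation.Nullary.Negation using (contradiction)
open import Relation.Unary using (Decidable)

open import Algebra.Lattice.Properties.BooleanAlgebra ∨-∧-booleanAlgebra using (deMorgan₁; deMorgan₂)
open import Algebra.Properties.CommutativeSemigroup +-commutativeSemigroup using (interchange)
open import Algebra.Properties.Semiring.Sum +-*-semiring
  using (sum; sum-syntax; sum-cong-≗; sum-replicate-zero; ∑-distrib-+; ∑-comm; *-distribʳ-sum)

open Equivalence using (to; from)

-- Boolean vertex and arc sets, finite sums

VertexSet : ℕ → Set
VertexSet n = Fin n → Bool

ArcSet : ℕ → Set
ArcSet n = Fin n → VertexSet n

bit : Bool → ℕ
bit b = if b then 1 else 0

#_ : ∀ {n} → VertexSet n → ℕ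
#_ {n} X = ∑[ v < n ] bit (X v)

bit≤1 : ∀ b → bit b ≤ 1
bit≤1 true  = ≤-refl
bit≤1 false = z≤n

bit-mono : ∀ a b → (T a → T b) → bit a ≤ bit b
bit-mono true  true  _ = ≤-refl
bit-mono true  false h = ⊥-elim (h tt)
bit-mono false _     _ = z≤n

sum-mono : ∀ {n} {f g : Fin n → ℕ} → (∀ i → f i ≤ g i) → sum f ≤ sum g
sum-mono {zero}  f≤g = z≤n
sum-mono {suc n} f≤g = +-mono-≤ (f≤g zero) (sum-mono (f≤g ∘ suc))

sum-mono-< : ∀ {n} {f g : Fin n → ℕ} → (∀ i → f i ≤ g i) → ∀ i → f i < g i → sum f < sum g
sum-mono-< f≤g zero    lt = +-mono-<-≤ lt (sum-mono (f≤g ∘ suc))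
sum-mono-< f≤g (suc i) lt = +-mono-≤-< (f≤g zero) (sum-mono-< (f≤g ∘ suc) i lt)

-- A unit loss at a single index is what deleting one arc or one vertex costs a count.
sum-mono-except : ∀ {n} {f g : Fin n → ℕ} i → (∀ j → j ≢ i → f j ≤ g j) →
                  f i ≤ suc (g i) → sum f ≤ suc (sum g)
sum-mono-except zero    f≤g le = +-mono-≤ le (sum-mono λ j → f≤g (suc j) λ ())
sum-mono-except {f = f} {g} (suc i) f≤g le =
  subst (sum f ≤_) (+-suc (g zero) (sum (g ∘ suc)))
    (+-mono-≤ (f≤g zero λ ())
              (sum-mono-except i (λ j j≢i → f≤g (suc j) λ { refl → j≢i refl }) le))

term≤sum : ∀ {n} (f : Fin n → ℕ) i → f i ≤ sum f
term≤sum f zero    = m≤m+n _ _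
term≤sum f (suc i) = ≤-trans (term≤sum (f ∘ suc) i) (m≤n+m _ _)

sum≤*bound : ∀ {n} (f : Fin n → ℕ) k → (∀ i → f i ≤ k) → sum f ≤ n * k
sum≤*bound {zero}  f k f≤k = z≤n
sum≤*bound {suc n} f k f≤k = +-mono-≤ (f≤k zero) (sum≤*bound (f ∘ suc) k (f≤k ∘ suc))

-- Mixed cuts and linkage

arcs : ∀ {n} → ArcSet n → ℕ
arcs {n} G = ∑[ u < n ] ∑[ v < n ] bit (G u v)

_⊑_ : ∀ {n} → ArcSet n → ArcSet n → Set
F ⊑ G = ∀ u v → T (F u v) → T (G u v)

indeg : ∀ {n} → ArcSet n → Fin n → ℕ
indeg {n} G v = ∑[ u < n ] bit (G u v)

-- (Q , O) is a separation with separator the vertices outside both Q and O, the counted arcs leading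
-- from O to Q.  Q and O may overlap: submodularity holds regardless.
boundaryAt : ∀ {n} → ArcSet n → VertexSet n → VertexSet n → Fin n → ℕ
boundaryAt {n} G Q O u = bit (not (Q u) ∧ not (O u)) + ∑[ v < n ] bit (G u v ∧ O u ∧ Q v)

cutSize : ∀ {n} → ArcSet n → VertexSet n → VertexSet n → ℕ
cutSize G Q O = sum (boundaryAt G Q O)

Avoids : ∀ {n} → VertexSet n → VertexSet n → Set
Avoids B Q = ∀ b → T (B b) → ¬ T (Q b)

-- Cut form of robust reachability: after the deletion of fewer than `k` vertices, `B` still reaches
-- every remaining vertex. Counting arcs as well as vertices in a cut is what lets a tight cut bound
-- an indegree.
Linked : ∀ {n} → ℕ → VertexSet n → ArcSet n → Set
Linked k B G = ∀ Q O v → T (Q v) → Avoids B Q → k ≤ cutSize G Q O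

Violation : ∀ {n} → ℕ → VertexSet n → ArcSet n → VertexSet n → VertexSet n → Set
Violation k B G Q O = (∃ λ v → T (Q v)) × Avoids B Q × cutSize G Q O < k

violation? : ∀ {n} k (B : VertexSet n) G Q O → Dec (Violation k B G Q O)
violation? k B G Q O =
  any? (T? ∘ Q) ×-dec all? (λ b → T? (B b) →-dec ¬? (T? (Q b))) ×-dec (_ <? k)

cutSize-cong : ∀ {n} (G : ArcSet n) {Q Q′ O O′} → Q ≗ Q′ → O ≗ O′ → cutSize G Q O ≡ cutSize G Q′ O′
cutSize-cong G Q≗ O≗ = sum-cong-≗ λ u → cong₂ _+_
  (cong₂ (λ q o → bit (not q ∧ not o)) (Q≗ u) (O≗ u))
  (sum-cong-≗ λ v → cong₂ (λ o q → bit (G u v ∧ o ∧ q)) (O≗ u) (Q≗ v))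

-- Linkage quantifies over functions, so the exhaustive search runs over `Subset`, and
-- `cutSize-cong` relates a function to its tabulation. A failure comes with a violating cut.
linked-or-violated : ∀ {n} k (B : VertexSet n) G → Linked k B G ⊎ ∃₂ (Violation k B G)
linked-or-violated k B G
  with anySubset? (λ q → anySubset? (λ o → violation? k B G (Vec.lookup q) (Vec.lookup o)))
... | yes (q , o , viol) = inj₂ (Vec.lookup q , Vec.lookup o , viol)
... | no none = inj₁ λ Q O v v∈Q avoids → ≮⇒≥ λ small → none
  ( Vec.tabulate Q , Vec.tabulate O
  , (v , subst T (sym (lookup∘tabulate Q v)) v∈Q)
  , (λ b b∈B b∈Q → avoids b b∈B (subst T (lookup∘tabulate Q b) b∈Q))
  , subst (_< k) (sym (cutSize-cong G (lookup∘tabulate Q) (lookup∘tabulate O))) small)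

linked? : ∀ {n} k (B : VertexSet n) G → Dec (Linked k B G)
linked? k B G with linked-or-violated k B G
... | inj₁ linked = yes linked
... | inj₂ (Q , O , (v , v∈Q) , avoids , small) =
  no λ linked → <⇒≱ small (linked Q O v v∈Q avoids)

-- Submodularity of the cut size

bit-submodular : ∀ a₁ a₂ b₁ b₂ →
  bit ((a₁ ∨ a₂) ∧ (b₁ ∧ b₂)) + bit ((a₁ ∧ a₂) ∧ (b₁ ∨ b₂)) ≤ bit (a₁ ∧ b₁) + bit (a₂ ∧ b₂)
bit-submodular false false b₁    b₂    = z≤n
bit-submodular false true  true  b₂    = ≤-reflexive (+-identityʳ _)
bit-submodular false true  false b₂    = z≤n
bit-submodular true  false true  true  = ≤-refl
bit-submodular true  false true  false = z≤n
bit-submodular true  false false b₂    = z≤n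
bit-submodular true  true  true  true  = ≤-refl
bit-submodular true  true  true  false = ≤-refl
bit-submodular true  true  false b₂    = ≤-refl

_∩_ _∪_ : ∀ {n} → VertexSet n → VertexSet n → VertexSet n
(X ∩ Y) v = X v ∧ Y v
(X ∪ Y) v = X v ∨ Y v

-- Separations are ordered by inclusion in `Q` and by reverse inclusion in `O`, so intersections on
-- one side are paired with unions on the other.
Submodular : ∀ {n} → (VertexSet n → VertexSet n → ℕ) → Set
Submodular φ = ∀ Q₁ Q₂ O₁ O₂ →
  φ (Q₁ ∩ Q₂) (O₁ ∪ O₂) + φ (Q₁ ∪ Q₂) (O₁ ∩ O₂) ≤ φ Q₁ O₁ + φ Q₂ O₂

+-submodular : ∀ {n} (φ ψ : VertexSet n → VertexSet n → ℕ) →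
               Submodular φ → Submodular ψ → Submodular (λ Q O → φ Q O + ψ Q O)
+-submodular φ ψ φ-sub ψ-sub Q₁ Q₂ O₁ O₂ = begin
  (φ Q∩ O∪ + ψ Q∩ O∪) + (φ Q∪ O∩ + ψ Q∪ O∩) ≡⟨ interchange (φ Q∩ O∪) _ _ _ ⟩
  (φ Q∩ O∪ + φ Q∪ O∩) + (ψ Q∩ O∪ + ψ Q∪ O∩) ≤⟨ +-mono-≤ (φ-sub Q₁ Q₂ O₁ O₂) (ψ-sub Q₁ Q₂ O₁ O₂) ⟩
  (φ Q₁ O₁ + φ Q₂ O₂) + (ψ Q₁ O₁ + ψ Q₂ O₂) ≡⟨ interchange (φ Q₁ O₁) _ _ _ ⟩
  (φ Q₁ O₁ + ψ Q₁ O₁) + (φ Q₂ O₂ + ψ Q₂ O₂) ∎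
  where
  open ≤-Reasoning
  Q∩ = Q₁ ∩ Q₂
  Q∪ = Q₁ ∪ Q₂
  O∩ = O₁ ∩ O₂
  O∪ = O₁ ∪ O₂

∑-submodular : ∀ {m n} (φ : Fin m → VertexSet n → VertexSet n → ℕ) →
               (∀ i → Submodular (φ i)) → Submodular (λ Q O → ∑[ i < m ] φ i Q O)
∑-submodular {m} φ φ-sub Q₁ Q₂ O₁ O₂ = begin
  ∑[ i < m ] φ i Q∩ O∪ + ∑[ i < m ] φ i Q∪ O∩ ≡⟨ ∑-distrib-+ (λ i → φ i Q∩ O∪) _ ⟨
  ∑[ i < m ] (φ i Q∩ O∪ + φ i Q∪ O∩)          ≤⟨ sum-mono (λ i → φ-sub i Q₁ Q₂ O₁ O₂) ⟩
  ∑[ i < m ] (φ i Q₁ O₁ + φ i Q₂ O₂)          ≡⟨ ∑-distrib-+ (λ i → φ i Q₁ O₁) _ ⟩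
  ∑[ i < m ] φ i Q₁ O₁ + ∑[ i < m ] φ i Q₂ O₂ ∎
  where
  open ≤-Reasoning
  Q∩ = Q₁ ∩ Q₂
  Q∪ = Q₁ ∪ Q₂
  O∩ = O₁ ∩ O₂
  O∪ = O₁ ∪ O₂

cutSize-submodular : ∀ {n} (G : ArcSet n) → Submodular (cutSize G)
cutSize-submodular {n} G = ∑-submodular (λ u Q O → boundaryAt G Q O u) λ u →
  +-submodular (λ Q O → bit (not (Q u) ∧ not (O u)))
               (λ Q O → ∑[ v < n ] bit (G u v ∧ O u ∧ Q v))
    (λ Q₁ Q₂ O₁ O₂ → vertex (Q₁ u) (Q₂ u) (O₁ u) (O₂ u))
    (∑-submodular (λ v Q O → bit (G u v ∧ O u ∧ Q v))
      λ v Q₁ Q₂ O₁ O₂ → arc (G u v) (O₁ u) (O₂ u) (Q₁ v) (Q₂ v))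
  where
  vertex : ∀ q₁ q₂ o₁ o₂ →
    bit (not (q₁ ∧ q₂) ∧ not (o₁ ∨ o₂)) + bit (not (q₁ ∨ q₂) ∧ not (o₁ ∧ o₂)) ≤
    bit (not q₁ ∧ not o₁) + bit (not q₂ ∧ not o₂)
  -- De Morgan turns the vertex term into the same pointwise inequality as the arc term, read on
  -- complements.
  vertex q₁ q₂ o₁ o₂
    rewrite deMorgan₁ q₁ q₂ | deMorgan₂ o₁ o₂ | deMorgan₂ q₁ q₂ | deMorgan₁ o₁ o₂
    = bit-submodular (not q₁) (not q₂) (not o₁) (not o₂)
  arc : ∀ g o₁ o₂ q₁ q₂ →
    bit (g ∧ (o₁ ∨ o₂) ∧ (q₁ ∧ q₂)) + bit (g ∧ (o₁ ∧ o₂) ∧ (q₁ ∨ q₂)) ≤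
    bit (g ∧ o₁ ∧ q₁) + bit (g ∧ o₂ ∧ q₂)
  arc true  = bit-submodular
  arc false _ _ _ _ = z≤n

-- Arc deletion and linked subgraphs of small indegree

delete : ∀ {n} → ArcSet n → Fin n → Fin n → ArcSet n
delete G u v x y = G x y ∧ not (does (x ≟ u) ∧ does (y ≟ v))

delete-⊑ : ∀ {n} (G : ArcSet n) u v → delete G u v ⊑ G
delete-⊑ G u v x y = proj₁ ∘ to T-∧

delete-removes : ∀ {n} (G : ArcSet n) u v → ¬ T (delete G u v u v)
delete-removes G u v t with u ≟ u | v ≟ v | to (T-∧ {G u v}) t
... | yes _ | yes _ | _ , ()
... | no ¬p | _     | _ = ¬p refl
... | yes _ | no ¬p | _ = ¬p refl

delete-keeps : ∀ {n} (G : ArcSet n) u v x y → T (G x y) → ¬ (x ≡ u × y ≡ v) → T (delete G u v x y)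
delete-keeps G u v x y t ne with x ≟ u | y ≟ v
... | yes p | yes q = contradiction (p , q) ne
... | yes p | no  _ = from T-∧ (t , tt)
... | no  _ | _     = from T-∧ (t , tt)

arcs-delete : ∀ {n} (G : ArcSet n) u v → T (G u v) → arcs (delete G u v) < arcs G
arcs-delete G u v t = sum-mono-< (λ x → sum-mono (le x)) u (sum-mono-< (le u) v lt)
  where
  le : ∀ x y → bit (delete G u v x y) ≤ bit (G x y)
  le x y = bit-mono _ _ (delete-⊑ G u v x y)
  lt : bit (delete G u v u v) < bit (G u v)
  lt with G u v | delete G u v u v | delete-removes G u v
  ... | true | false | _ = ≤-refl
  ... | true | true  | h = ⊥-elim (h tt)

cut-arc-kept : ∀ {n} (G : ArcSet n) u v (Q O : VertexSet n) x y →
  T (G x y ∧ O x ∧ Q y) → ¬ (x ≡ u × y ≡ v) → T (delete G u v x y ∧ O x ∧ Q y)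
cut-arc-kept G u v Q O x y t ne =
  let g , oq = to T-∧ t in from T-∧ (delete-keeps G u v x y g ne , oq)

cutSize-delete : ∀ {n} (G : ArcSet n) u v Q O → cutSize G Q O ≤ suc (cutSize (delete G u v) Q O)
cutSize-delete G u v Q O = sum-mono-except u
  (λ x x≢u → +-monoʳ-≤ (bit (not (Q x) ∧ not (O x))) (sum-mono λ y →
    bit-mono _ _ λ t → cut-arc-kept G u v Q O x y t (x≢u ∘ proj₁)))
  (≤-trans
    (+-monoʳ-≤ (bit (not (Q u) ∧ not (O u))) (sum-mono-except v
      (λ y y≢v → bit-mono _ _ λ t → cut-arc-kept G u v Q O u y t (y≢v ∘ proj₂))
      (≤-trans (bit≤1 _) (s≤s z≤n))))
    (≤-reflexive (+-suc _ _)))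

cutSize-delete-uncrossed : ∀ {n} (G : ArcSet n) u v Q O → ¬ (T (O u) × T (Q v)) →
                           cutSize G Q O ≤ cutSize (delete G u v) Q O
cutSize-delete-uncrossed G u v Q O uncrossed =
  sum-mono λ x → +-monoʳ-≤ (bit (not (Q x) ∧ not (O x))) (sum-mono λ y → bit-mono _ _ λ t →
    cut-arc-kept G u v Q O x y t λ { (refl , refl) →
      uncrossed (to T-∧ (proj₂ (to (T-∧ {G u v}) t))) })

-- The upper bound suffices as a field: in a linked `G` the reverse inequality follows, because `v`
-- keeps `inside` nonempty.
record Tight {n} (k : ℕ) (B : VertexSet n) (G : ArcSet n) (v : Fin n) : Set where
  field
    inside outside : VertexSet n
    v∈inside       : T (inside v)
    avoids         : Avoids B inside
    tight          : cutSize G inside outside ≤ k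

open Tight

-- A cut that violates linkage after the deletion had size at least `k` before it. Deleting an arc
-- costs a cut at most one, and nothing if the arc does not cross it; hence the arc crosses this
-- cut, which had size at most `k`.
critical⇒tight : ∀ {n k} {B : VertexSet n} {G} → Linked k B G → ∀ u v →
  ¬ Linked k B (delete G u v) → Σ[ t ∈ Tight k B G v ] T (outside t u)
critical⇒tight {k = k} {B} {G} linked u v critical with linked-or-violated k B (delete G u v)
... | inj₁ linked′ = contradiction linked′ critical
... | inj₂ (Q , O , (w , w∈Q) , avoids , small) with T? (O u) ×-dec T? (Q v)
...   | no uncrossed = contradiction
        (≤-trans (linked Q O w w∈Q avoids) (cutSize-delete-uncrossed G u v Q O uncrossed))
        (<⇒≱ small)
...   | yes (u∈O , v∈Q) = record
        { inside = Q ; outside = O ; v∈inside = v∈Q ; avoids = avoids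
        ; tight = ≤-trans (cutSize-delete G u v Q O) small } , u∈O

-- Uncrossing: the join of the two cuts also contains `v` and avoids `B`, so it has size at least
-- `k`, and submodularity leaves at most `k` for the meet. The outside of the meet is a union, so
-- every arc into `v` that crosses one of the cuts crosses the meet.
tight-meet : ∀ {n k} {B : VertexSet n} {G v} → Linked k B G → (s t : Tight k B G v) →
  Σ[ m ∈ Tight k B G v ] (∀ x → T (outside s x) ⊎ T (outside t x) → T (outside m x))
tight-meet {k = k} {B} {G} {v} linked s t =
  record
    { inside = inside s ∩ inside t
    ; outside = outside s ∪ outside t
    ; v∈inside = from T-∧ (v∈inside s , v∈inside t)
    ; avoids = λ b b∈B b∈st → avoids s b b∈B (proj₁ (to T-∧ b∈st))
    ; tight = +-cancelʳ-≤ k _ _ (begin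
        cutSize G (inside s ∩ inside t) (outside s ∪ outside t) + k
          ≤⟨ +-monoʳ-≤ (cutSize G (inside s ∩ inside t) (outside s ∪ outside t))
               (linked (inside s ∪ inside t) (outside s ∩ outside t) v
                 (from T-∨ (inj₁ (v∈inside s)))
                 λ b b∈B b∈st → [ avoids s b b∈B , avoids t b b∈B ] (to T-∨ b∈st)) ⟩
        cutSize G (inside s ∩ inside t) (outside s ∪ outside t) +
        cutSize G (inside s ∪ inside t) (outside s ∩ outside t)
          ≤⟨ cutSize-submodular G (inside s) (inside t) (outside s) (outside t) ⟩
        cutSize G (inside s) (outside s) + cutSize G (inside t) (outside t)
          ≤⟨ +-mono-≤ (tight s) (tight t) ⟩
        k + k ∎)
    }
  , λ x → from T-∨
  where open ≤-Reasoning

Critical : ∀ {n} → ℕ → VertexSet n → ArcSet n → Set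
Critical k B G = ∀ u v → T (G u v) → ¬ Linked k B (delete G u v)

-- Folds `tight-meet` over the inneighbours of `v` among `xs`. The first alternative is the empty
-- meet: without an inneighbour there is no tight cut to start from.
tight-excluding : ∀ {n k} {B : VertexSet n} {G} → Linked k B G → Critical k B G → ∀ v xs →
  (∀ x → x ∈ xs → ¬ T (G x v)) ⊎
  (Σ[ t ∈ Tight k B G v ] ∀ x → x ∈ xs → T (G x v) → T (outside t x))
tight-excluding linked critical v [] = inj₁ λ _ ()
tight-excluding {G = G} linked critical v (x ∷ xs)
  with T? (G x v) | tight-excluding linked critical v xs
... | no x↛v | inj₁ none = inj₁ λ { _ (here refl) → x↛v ; y (there y∈xs) → none y y∈xs }
... | no x↛v | inj₂ (t , out) =
  inj₂ (t , λ { _ (here refl) x→v → contradiction x→v x↛v ; y (there y∈xs) → out y y∈xs })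
... | yes x→v | inj₁ none with critical⇒tight linked x v (critical x v x→v)
...   | t , x∈out =
  inj₂ (t , λ { _ (here refl) _ → x∈out ; y (there y∈xs) y→v → contradiction y→v (none y y∈xs) })
tight-excluding {G = G} linked critical v (x ∷ xs)
    | yes x→v | inj₂ (t , out) with critical⇒tight linked x v (critical x v x→v)
...   | s , x∈out with tight-meet linked s t
...     | m , incl =
  inj₂ (m , λ { _ (here refl) _ → incl _ (inj₁ x∈out)
              ; y (there y∈xs) y→v → incl y (inj₂ (out y y∈xs y→v)) })

-- All arcs into v cross one tight cut, the meet of the tight cuts crossed by each of them.
critical⇒indeg≤k : ∀ {n k} {B : VertexSet n} {G} → Linked k B G → Critical k B G → ∀ v → indeg G v ≤ k
critical⇒indeg≤k {n} {k} {B} {G} linked critical v with tight-excluding linked critical v (allFin n)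
... | inj₁ none = ≤-trans (sum-mono λ x → bit-mono _ false (none x (∈-allFin x)))
                          (≤-trans (≤-reflexive (sum-replicate-zero n)) z≤n)
... | inj₂ (t , out) = ≤-trans (sum-mono below) (tight t)
  where
  below : ∀ x → bit (G x v) ≤ boundaryAt G (inside t) (outside t) x
  below x = begin
    bit (G x v)
      ≤⟨ bit-mono _ _ (λ x→v → from T-∧ (x→v , from T-∧ (out x (∈-allFin x) x→v , v∈inside t))) ⟩
    bit (G x v ∧ outside t x ∧ inside t v)
      ≤⟨ term≤sum (λ y → bit (G x y ∧ outside t x ∧ inside t y)) v ⟩
    ∑[ y < n ] bit (G x y ∧ outside t x ∧ inside t y)
      ≤⟨ m≤n+m _ _ ⟩
    boundaryAt G (inside t) (outside t) x ∎
    where open ≤-Reasoning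

-- Redundant arcs are deleted one by one until every arc is critical. The fuel `m` exceeds the
-- number of arcs, which each deletion lowers.
sparsify : ∀ {n} k (B : VertexSet n) m G → arcs G < m → Linked k B G →
           ∃ λ F → F ⊑ G × Linked k B F × (∀ v → indeg F v ≤ k)
sparsify k B (suc m) G (s≤s arcs≤m) linked
  with any? (λ u → any? (λ v → T? (G u v) ×-dec linked? k B (delete G u v)))
... | yes (u , v , u→v , linked′) =
  let F , F⊑ , rest = sparsify k B m (delete G u v) (<-≤-trans (arcs-delete G u v u→v) arcs≤m) linked′
  in  F , (λ x y → delete-⊑ G u v x y ∘ F⊑ x y) , rest
... | no none = G , (λ _ _ → id) , linked
              , critical⇒indeg≤k linked λ u v u→v linked′ → none (u , v , u→v , linked′)

-- Cardinality of vertex sets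

_⊆_ : ∀ {n} → VertexSet n → VertexSet n → Set
X ⊆ Y = ∀ v → T (X v) → T (Y v)

#-mono : ∀ {n} {X Y : VertexSet n} → X ⊆ Y → # X ≤ # Y
#-mono X⊆Y = sum-mono λ v → bit-mono _ _ (X⊆Y v)

#-mono-< : ∀ {n} {X Y : VertexSet n} → X ⊆ Y → ∀ v → ¬ T (X v) → T (Y v) → # X < # Y
#-mono-< {X = X} {Y} X⊆Y v v∉X v∈Y = sum-mono-< (λ w → bit-mono _ _ (X⊆Y w)) v (lt (X v) (Y v) v∉X v∈Y)
  where
  lt : ∀ x y → ¬ T x → T y → bit x < bit y
  lt false true  _   _ = ≤-refl
  lt true  _     ¬tt _ = ⊥-elim (¬tt tt)

#≤n : ∀ {n} (X : VertexSet n) → # X ≤ n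
#≤n {n} X = subst (# X ≤_) (*-identityʳ n) (sum≤*bound _ 1 λ v → bit≤1 (X v))

#<⇒∃∖ : ∀ {n} (X Y : VertexSet n) → # X < # Y → ∃ λ v → T (Y v) × ¬ T (X v)
#<⇒∃∖ X Y lt with any? (λ v → T? (Y v) ×-dec ¬? (T? (X v)))
... | yes found = found
... | no  none  = contradiction (#-mono λ v v∈Y → in-X v v∈Y) (<⇒≱ lt)
  where
  in-X : Y ⊆ X
  in-X v v∈Y with T? (X v)
  ... | yes v∈X = v∈X
  ... | no  v∉X = contradiction (v , v∈Y , v∉X) none

#>0⇒∃ : ∀ {n} (X : VertexSet n) → 0 < # X → ∃ λ v → T (X v)
#>0⇒∃ {n} X lt =
  let v , v∈X , _ = #<⇒∃∖ (const false) X (subst (_< # X) (sym (sum-replicate-zero n)) lt) in v , v∈X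

_∖ᵛ_ : ∀ {n} → VertexSet n → Fin n → VertexSet n
(X ∖ᵛ a) v = X v ∧ not (does (v ≟ a))

insert : ∀ {n} → Fin n → VertexSet n → VertexSet n
insert a X v = does (v ≟ a) ∨ X v

∈-insert : ∀ {n} a (X : VertexSet n) → T (insert a X a)
∈-insert a X with a ≟ a
... | yes _  = tt
... | no a≢a = contradiction refl a≢a

insert-⊇ : ∀ {n} a (X : VertexSet n) → X ⊆ insert a X
insert-⊇ a X v v∈X = from T-∨ (inj₂ v∈X)

insert⁻ : ∀ {n} a (X : VertexSet n) v → T (insert a X v) → v ≡ a ⊎ T (X v)
insert⁻ a X v t with v ≟ a
... | yes v≡a = inj₁ v≡a
... | no  _   = inj₂ t

∖ᵛ-⊆ : ∀ {n} (X : VertexSet n) a → (X ∖ᵛ a) ⊆ X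
∖ᵛ-⊆ X a v = proj₁ ∘ to T-∧

∉-∖ᵛ : ∀ {n} (X : VertexSet n) a → ¬ T ((X ∖ᵛ a) a)
∉-∖ᵛ X a t with a ≟ a | to (T-∧ {X a}) t
... | yes _  | _ , ()
... | no a≢a | _ = a≢a refl

#-∖ᵛ : ∀ {n} (X : VertexSet n) a → # X ≤ suc (# (X ∖ᵛ a))
#-∖ᵛ X a = sum-mono-except a (λ v v≢a → bit-mono _ _ (kept v v≢a)) (≤-trans (bit≤1 _) (s≤s z≤n))
  where
  kept : ∀ v → v ≢ a → T (X v) → T ((X ∖ᵛ a) v)
  kept v v≢a v∈X with v ≟ a
  ... | yes v≡a = contradiction v≡a v≢a
  ... | no  _   = from T-∧ (v∈X , tt)

initial : ∀ {n} → ℕ → VertexSet n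
initial m v = toℕ v <ᵇ m

#-initial : ∀ {n m} → m ≤ n → # (initial {n} m) ≡ m
#-initial {n} z≤n   = sum-replicate-zero n
#-initial (s≤s m≤n) = cong suc (#-initial m≤n)

-- From strong connectivity to linkage

-- What strong `k`-connectivity provides, freed of walks: a walk from `x` to `y` that avoids `S`
-- must enter `Q` somewhere.
Crossing : ∀ {n} → ℕ → ArcSet n → Set
Crossing {n} k G = ∀ (S Q : VertexSet n) x y → # S < k → ¬ T (S x) → ¬ T (S y) → ¬ T (Q x) → T (Q y) →
  ∃₂ λ u v → T (G u v) × ¬ T (S u) × ¬ T (S v) × ¬ T (Q u) × T (Q v)

¬T⇒T-not : ∀ {b} → ¬ T b → T (not b)
¬T⇒T-not {true}  ¬t = ¬t tt
¬T⇒T-not {false} _  = tt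

T⇒¬T-not : ∀ {b} → T b → ¬ T (not b)
T⇒¬T-not {true} _ ()

T-not⇒¬T : ∀ {b} → T (not b) → ¬ T b
T-not⇒¬T {true} ()

¬T-not⇒T : ∀ {b} → ¬ T (not b) → T b
¬T-not⇒T {true}  _  = tt
¬T-not⇒T {false} ¬t = ¬t tt

-- Replacing `Q` by its complement and exchanging `x` and `y` reverses the direction of crossing.
crossing-flip : ∀ {n k} {G : ArcSet n} → Crossing k G → Crossing k (flip G)
crossing-flip crossing S Q x y small x∉S y∉S x∉Q y∈Q =
  let u , v , u→v , u∉S , v∉S , u∉ , v∈ =
        crossing S (not ∘ Q) y x small y∉S x∉S (T⇒¬T-not y∈Q) (¬T⇒T-not x∉Q)
  in  v , u , u→v , v∉S , u∉S , T-not⇒¬T v∈ , ¬T-not⇒T u∉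

-- For a cut smaller than `k`, let `S` consist of the vertices outside `Q` that contribute to it:
-- separator vertices and tails of cut arcs. Then `S` has fewer than `k` elements and misses some
-- `b` in `B`, so an arc enters `Q` from outside `S`. But its tail contributes to the cut, as a
-- separator vertex or as the tail of a cut arc.
crossing⇒linked : ∀ {n k} {B : VertexSet n} {G} → Crossing k G → k ≤ # B → Linked k B G
crossing⇒linked {n} {k} {B} {G} crossing k≤#B Q O y y∈Q avoids = ≮⇒≥ λ small →
  let #S<k              = ≤-<-trans (sum-mono #S≤) small
      b , b∈B , b∉S     = #<⇒∃∖ S B (<-≤-trans #S<k k≤#B)
      u , v , u→v , u∉S , _ , u∉Q , v∈Q =
        crossing S Q b y #S<k b∉S (λ y∈S → T-not⇒¬T (proj₁ (to T-∧ y∈S)) y∈Q) (avoids b b∈B) y∈Q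
  in  u∉S (from T-∧ (¬T⇒T-not u∉Q , <⇒<ᵇ (positive u v u→v u∉Q v∈Q)))
  where
  S : VertexSet n
  S u = not (Q u) ∧ (0 <ᵇ boundaryAt G Q O u)
  #S≤ : ∀ u → bit (S u) ≤ boundaryAt G Q O u
  #S≤ u with not (Q u) | boundaryAt G Q O u
  ... | false | _     = z≤n
  ... | true  | zero  = z≤n
  ... | true  | suc _ = s≤s z≤n
  positive : ∀ u v → T (G u v) → ¬ T (Q u) → T (Q v) → 0 < boundaryAt G Q O u
  positive u v u→v u∉Q v∈Q with T? (O u)
  ... | yes u∈O = ≤-trans
    (bit-mono true _ λ _ → from T-∧ (u→v , from T-∧ (u∈O , v∈Q)))
    (≤-trans (term≤sum (λ v → bit (G u v ∧ O u ∧ Q v)) v) (m≤n+m _ _))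
  ... | no  u∉O = ≤-trans
    (bit-mono true _ λ _ → from T-∧ (¬T⇒T-not u∉Q , ¬T⇒T-not u∉O))
    (m≤m+n _ _)

-- Degrees and arc counts in tournaments

record Tournament {n} (G : ArcSet n) : Set where
  field
    irrefl : ∀ v → ¬ T (G v v)
    asym   : ∀ u v → T (G u v) → ¬ T (G v u)
    total  : ∀ u v → u ≢ v → T (G u v) ⊎ T (G v u)

open Tournament

tournament-flip : ∀ {n} {G : ArcSet n} → Tournament G → Tournament (flip G)
tournament-flip t = record
  { irrefl = irrefl t
  ; asym   = λ u v → asym t v u
  ; total  = λ u v u≢v → swap (total t u v u≢v) }

outdegIn : ∀ {n} → ArcSet n → VertexSet n → Fin n → ℕ
outdegIn G X u = # (X ∩ G u)

degree-sum : ∀ {n} {G : ArcSet n} → Tournament G → ∀ X u → T (X u) →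
             # X ≡ suc (outdegIn G X u + outdegIn (flip G) X u)
degree-sum {n} {G} t X u u∈X =
  trans (≤-antisym (sum-mono-except u lower (≤-trans (bit≤1 _) (s≤s z≤n)))
                   (sum-mono-< upper u (strict (X u) (G u u) u∈X (irrefl t u))))
        (cong suc (∑-distrib-+ (λ v → bit (X v ∧ G u v)) (λ v → bit (X v ∧ G v u))))
  where
  lower : ∀ v → v ≢ u → bit (X v) ≤ bit (X v ∧ G u v) + bit (X v ∧ G v u)
  lower v v≢u with X v | G u v | G v u | total t u v (v≢u ∘ sym)
  ... | false | _     | _     | _ = z≤n
  ... | true  | true  | _     | _ = s≤s z≤n
  ... | true  | false | true  | _ = ≤-refl
  ... | true  | false | false | inj₁ ()
  ... | true  | false | false | inj₂ ()
  upper : ∀ v → bit (X v ∧ G u v) + bit (X v ∧ G v u) ≤ bit (X v)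
  upper v with X v | G u v | G v u | asym t u v
  ... | false | _     | _     | _ = z≤n
  ... | true  | true  | true  | h = ⊥-elim (h tt tt)
  ... | true  | true  | false | _ = ≤-refl
  ... | true  | false | true  | _ = ≤-refl
  ... | true  | false | false | _ = z≤n
  strict : ∀ x g → T x → ¬ T g → bit (x ∧ g) + bit (x ∧ g) < bit x
  strict true true  _ h = ⊥-elim (h tt)
  strict true false _ _ = ≤-refl

induced : ∀ {n} → ArcSet n → VertexSet n → ArcSet n
induced G X u v = X u ∧ X v ∧ G u v

arcs-flip : ∀ {n} (G : ArcSet n) → arcs (flip G) ≡ arcs G
arcs-flip G = ∑-comm λ u v → bit (G v u)

arcs-induced-flip : ∀ {n} (G : ArcSet n) X → arcs (induced (flip G) X) ≡ arcs (induced G X)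
arcs-induced-flip G X = trans
  (sum-cong-≗ λ u → sum-cong-≗ λ v → cong bit (∧-left-comm (X u) (X v) (G v u)))
  (arcs-flip (induced G X))
  where
  ∧-left-comm : ∀ a b c → a ∧ b ∧ c ≡ b ∧ a ∧ c
  ∧-left-comm true  true  _ = refl
  ∧-left-comm true  false _ = refl
  ∧-left-comm false true  _ = refl
  ∧-left-comm false false _ = refl

-- Division-free form of the count |X|(|X| - 1)/2: summing `degree-sum` over `X` counts each arc
-- once at its tail and once at its head.
arcs-tournament : ∀ {n} {G : ArcSet n} → Tournament G → ∀ X →
                  # X * # X ≡ # X + (arcs (induced G X) + arcs (induced G X))
arcs-tournament {n} {G} t X = begin
  # X * # X                                             ≡⟨ *-distribʳ-sum (# X) (bit ∘ X) ⟩
  ∑[ u < n ] (bit (X u) * # X)                          ≡⟨ sum-cong-≗ row ⟩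
  ∑[ u < n ] (bit (X u) + (out u + in′ u))              ≡⟨ ∑-distrib-+ (bit ∘ X) _ ⟩
  # X + ∑[ u < n ] (out u + in′ u)                      ≡⟨ cong (# X +_) (∑-distrib-+ out in′) ⟩
  # X + (arcs (induced G X) + arcs (induced (flip G) X))
    ≡⟨ cong (λ m → # X + (arcs (induced G X) + m)) (arcs-induced-flip G X) ⟩
  # X + (arcs (induced G X) + arcs (induced G X))       ∎
  where
  open ≡-Reasoning
  out in′ : Fin n → ℕ
  out u = ∑[ v < n ] bit (induced G X u v)
  in′ u = ∑[ v < n ] bit (induced (flip G) X u v)
  row : ∀ u → bit (X u) * # X ≡ bit (X u) + (out u + in′ u)
  row u with X u | degree-sum t X u
  ... | false | _ = sym (cong₂ _+_ (sum-replicate-zero n) (sum-replicate-zero n))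
  ... | true  | h = trans (+-identityʳ (# X)) (h tt)

-- The average outdegree in X is (|X| - 1) / 2.
small-outdeg⇒small : ∀ {n} {G : ArcSet n} → Tournament G → ∀ X j →
                     (∀ w → T (X w) → outdegIn G X w < j) → # X ≤ j + j
small-outdeg⇒small {n} {G} t X j small = cancel (# X) (begin
  # X * # X                                       ≡⟨ arcs-tournament t X ⟩
  -- A second `# X` is added so that both halves become `# X + a`, to which the rowwise bound of one
  -- plus the outdegree by `j` applies.
  # X + (a + a)                                   ≤⟨ m≤n+m _ (# X) ⟩
  # X + (# X + (a + a))                           ≡⟨ solve 2 (λ x a → x :+ (x :+ (a :+ a)) := (x :+ a) :+ (x :+ a)) refl (# X) a ⟩
  (# X + a) + (# X + a)                           ≤⟨ +-mono-≤ bound bound ⟩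
  # X * j + # X * j                               ≡⟨ sym (*-distribˡ-+ (# X) j j) ⟩
  # X * (j + j)                                   ∎)
  where
  open ≤-Reasoning
  open +-*-Solver
  a : ℕ
  a = arcs (induced G X)
  cancel : ∀ x → x * x ≤ x * (j + j) → x ≤ j + j
  cancel zero      _ = z≤n
  cancel x@(suc _) h = *-cancelˡ-≤ x h
  row : ∀ u → bit (X u) + ∑[ v < n ] bit (induced G X u v) ≤ bit (X u) * j
  row u with X u | small u
  ... | false | _ = ≤-reflexive (sum-replicate-zero n)
  ... | true  | h = ≤-trans (h tt) (m≤m+n j 0)
  bound : # X + a ≤ # X * j
  bound = begin
    # X + a                       ≡⟨ sym (∑-distrib-+ (bit ∘ X) _) ⟩
    ∑[ u < n ] (bit (X u) + ∑[ v < n ] bit (induced G X u v)) ≤⟨ sum-mono row ⟩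
    ∑[ u < n ] (bit (X u) * j)    ≡⟨ sym (*-distribʳ-sum j (bit ∘ X)) ⟩
    # X * j                       ∎

-- Vertices of nearly maximal outdegree

Maximal : ∀ {n} → ArcSet n → VertexSet n → Fin n → Set
Maximal G Y a = T (Y a) × (∀ w → T (Y w) → outdegIn G Y w ≤ outdegIn G Y a)

-- A vertex w of Q ∩ Y dominates R ∩ Y, so the maximality of a leaves w few outneighbours in Q ∩ Y.
maximal⇒few-unreached : ∀ {n} {G : ArcSet n} → Tournament G → ∀ {Y a} → Maximal G Y a → ∀ R S Q →
  (∀ v → T (R v) ⊎ T (S v) ⊎ T (Q v)) → (∀ v → T (R v) → ¬ T (Q v)) → T (R a) →
  (∀ u v → T (R u) → T (Y u) → T (Q v) → T (Y v) → ¬ T (G u v)) →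
  # (Q ∩ Y) ≤ # S + # S
maximal⇒few-unreached {n} {G} t {Y} {a} (a∈Y , max) R S Q cover disjoint a∈R no-arc =
  small-outdeg⇒small t (Q ∩ Y) (# S) λ w w∈QY →
    let w∈Q , w∈Y = to T-∧ w∈QY in
    +-cancelʳ-≤ (# (R ∩ Y)) _ _ (begin
      suc (outdegIn G (Q ∩ Y) w + # (R ∩ Y)) ≤⟨ s≤s (dominates w w∈Q w∈Y) ⟩
      suc (outdegIn G Y w)                   ≤⟨ s≤s (max w w∈Y) ⟩
      suc (outdegIn G Y a)                   ≤⟨ confined ⟩
      # S + # (R ∩ Y)                        ∎)
  where
  open ≤-Reasoning
  dominates : ∀ w → T (Q w) → T (Y w) → outdegIn G (Q ∩ Y) w + # (R ∩ Y) ≤ outdegIn G Y w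
  dominates w w∈Q w∈Y = ≤-trans
    (≤-reflexive (sym (∑-distrib-+ (λ v → bit ((Q ∩ Y) v ∧ G w v)) (λ v → bit ((R ∩ Y) v)))))
    (sum-mono λ v → le v (T? (R v ∧ Y v)))
    where
    le : ∀ v → Dec (T (R v ∧ Y v)) →
         bit ((Q v ∧ Y v) ∧ G w v) + bit (R v ∧ Y v) ≤ bit (Y v ∧ G w v)
    le v (yes v∈RY) with to (T-∧ {R v}) v∈RY
    ... | v∈R , v∈Y with total t w v (λ { refl → disjoint w v∈R w∈Q })
    ...   | inj₂ v→w = ⊥-elim (no-arc v w v∈R v∈Y w∈Q w∈Y v→w)
    ...   | inj₁ w→v with Q v | R v | Y v | G w v | disjoint v
    ...     | true  | true | _    | _    | h = ⊥-elim (h tt tt)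
    ...     | false | true | true | true | _ = ≤-refl
    le v (no v∉RY) with Q v | R v | Y v | G w v | v∉RY
    ... | _     | true  | true  | _     | h = ⊥-elim (h tt)
    ... | true  | false | true  | true  | _ = ≤-refl
    ... | true  | false | true  | false | _ = z≤n
    ... | false | false | true  | _     | _ = z≤n
    ... | true  | true  | false | _     | _ = z≤n
    ... | true  | false | false | _     | _ = z≤n
    ... | false | true  | false | _     | _ = z≤n
    ... | false | false | false | _     | _ = z≤n
  -- The outneighbours of `a` in `Y` lie in `S` or `R`. The inequality is strict because `a` lies in
  -- `R ∩ Y` and is not its own outneighbour.
  confined : outdegIn G Y a < # S + # (R ∩ Y)
  confined = <-≤-trans (sum-mono-< (λ v → le v) a lt)
                       (≤-reflexive (∑-distrib-+ (bit ∘ S) (bit ∘ (R ∩ Y))))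
    where
    le : ∀ v → bit (Y v ∧ G a v) ≤ bit (S v) + bit (R v ∧ Y v)
    le v with Y v | G a v | R v | S v | Q v | cover v | no-arc a v a∈R a∈Y
    ... | false | _     | _     | _     | _     | _             | _ = z≤n
    ... | true  | false | _     | _     | _     | _             | _ = z≤n
    ... | true  | true  | _     | true  | _     | _             | _ = s≤s z≤n
    ... | true  | true  | true  | false | _     | _             | _ = ≤-refl
    ... | true  | true  | false | false | true  | _             | h = ⊥-elim (h tt tt tt)
    ... | true  | true  | false | false | false | inj₁ ()       | _
    ... | true  | true  | false | false | false | inj₂ (inj₁ ()) | _
    ... | true  | true  | false | false | false | inj₂ (inj₂ ()) | _
    lt : bit (Y a ∧ G a a) < bit (S a) + bit (R a ∧ Y a)
    lt with Y a | G a a | R a | irrefl t a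
    ... | true | true  | true | h = ⊥-elim (h tt)
    ... | true | false | true | _ = ≤-trans ≤-refl (m≤n+m _ _)

-- Hill climbing: the fuel bounds how far `d a` can still be raised, and `sum d` bounds every value
-- from above at the start.
argmax : ∀ {n} (d : Fin n → ℕ) (X : VertexSet n) → ∃ (T ∘ X) →
         ∃ λ a → T (X a) × (∀ w → T (X w) → d w ≤ d a)
argmax d X (x , x∈X) = climb (sum d) x x∈X λ w → ≤-trans (term≤sum d w) (m≤m+n _ _)
  where
  climb : ∀ m a → T (X a) → (∀ w → d w ≤ m + d a) → ∃ λ a → T (X a) × (∀ w → T (X w) → d w ≤ d a)
  climb zero    a a∈X bound = a , a∈X , λ w _ → bound w
  climb (suc m) a a∈X bound with any? (λ w → T? (X w) ×-dec (d a <? d w))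
  ... | no  none           = a , a∈X , λ w w∈X → ≮⇒≥ λ lt → none (w , w∈X , lt)
  ... | yes (b , b∈X , lt) = climb m b b∈X λ w → ≤-trans (bound w)
        (≤-trans (≤-reflexive (sym (+-suc m (d a)))) (+-monoʳ-≤ m lt))

-- The trace left by greedy selection: `core` is what remained of `X` when `a` was chosen, after the
-- removal of at most `j` vertices.
record NearlyMaximal {n} (G : ArcSet n) (X : VertexSet n) (j : ℕ) (a : Fin n) : Set where
  field
    core    : VertexSet n
    core⊆   : core ⊆ X
    large   : # X ≤ # core + j
    maximal : Maximal G core a

open NearlyMaximal

-- The first vertex chosen has all of `X` as its core. The others come from `X` without that vertex,
-- where induction leaves their cores short by at most `j - 1`, hence by at most `j` in `X`.
nearly-maximal : ∀ {n} (G : ArcSet n) j X → j < # X →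
  ∃ λ A → j < # A × A ⊆ X × (∀ a → T (A a) → NearlyMaximal G X j a)
nearly-maximal G j X j<#X with argmax (outdegIn G X) X (#>0⇒∃ X (≤-<-trans z≤n j<#X))
nearly-maximal G zero X j<#X | a , a∈X , max =
  insert a (const false)
  , ≤-trans (bit-mono true _ λ _ → ∈-insert a _) (term≤sum (bit ∘ insert a (const false)) a)
  , (λ v v∈ → ⊆X v (insert⁻ a _ v v∈))
  , λ v v∈ → nm v (insert⁻ a _ v v∈)
  where
  ⊆X : ∀ v → v ≡ a ⊎ T false → T (X v)
  ⊆X v (inj₁ refl) = a∈X
  nm : ∀ v → v ≡ a ⊎ T false → NearlyMaximal G X 0 v
  nm v (inj₁ refl) = record
    { core = X ; core⊆ = λ _ → id ; large = m≤m+n _ _ ; maximal = a∈X , max }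
nearly-maximal G (suc j) X j<#X | a , a∈X , max
  with nearly-maximal G j (X ∖ᵛ a) (s≤s⁻¹ (≤-trans j<#X (#-∖ᵛ X a)))
... | A , j<#A , A⊆ , A-max =
  insert a A
  , ≤-<-trans j<#A (#-mono-< (insert-⊇ a A) a (∉-∖ᵛ X a ∘ A⊆ a) (∈-insert a A))
  , (λ v v∈ → ⊆X v (insert⁻ a A v v∈))
  , λ v v∈ → nm v (insert⁻ a A v v∈)
  where
  ⊆X : ∀ v → v ≡ a ⊎ T (A v) → T (X v)
  ⊆X v (inj₁ refl) = a∈X
  ⊆X v (inj₂ v∈A)  = ∖ᵛ-⊆ X a v (A⊆ v v∈A)
  nm : ∀ v → v ≡ a ⊎ T (A v) → NearlyMaximal G X (suc j) v
  nm v (inj₁ refl) = record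
    { core = X ; core⊆ = λ _ → id ; large = m≤m+n _ _ ; maximal = a∈X , max }
  nm v (inj₂ v∈A) = let m = A-max v v∈A in record
    { core = core m
    ; core⊆ = λ w → ∖ᵛ-⊆ X a w ∘ core⊆ m w
    ; large = ≤-trans (#-∖ᵛ X a) (≤-trans (s≤s (large m)) (≤-reflexive (sym (+-suc _ j))))
    ; maximal = maximal m }

-- Maximality in the core leaves at most `2j` of its vertices in `Q`; at most `j` vertices of `X`
-- lie outside the core.
nearly-maximal⇒few-unreached : ∀ {n} {G : ArcSet n} → Tournament G → ∀ {X j a} → NearlyMaximal G X j a →
  ∀ R S Q → # S ≤ j →
  (∀ v → T (R v) ⊎ T (S v) ⊎ T (Q v)) → (∀ v → T (R v) → ¬ T (Q v)) → T (R a) →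
  (∀ u v → T (R u) → T (X u) → T (Q v) → T (X v) → ¬ T (G u v)) →
  # (Q ∩ X) ≤ j + j + j
nearly-maximal⇒few-unreached {n} {G} t {X} {j} m R S Q #S≤j cover disjoint a∈R no-arc =
  +-cancelʳ-≤ (# (core m)) _ _ (begin
    # (Q ∩ X) + # (core m)             ≤⟨ sum-+-≤ ⟩
    # (Q ∩ core m) + # X               ≤⟨ +-mono-≤ unreached (large m) ⟩
    (j + j) + (# (core m) + j)         ≡⟨ solve 2 (λ c j → (j :+ j) :+ (c :+ j) := j :+ j :+ j :+ c) refl (# (core m)) j ⟩
    j + j + j + # (core m)             ∎)
  where
  open ≤-Reasoning
  open +-*-Solver
  unreached : # (Q ∩ core m) ≤ j + j
  unreached = ≤-trans
    (maximal⇒few-unreached t (maximal m) R S Q cover disjoint a∈R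
      λ u v u∈R u∈Y v∈Q v∈Y → no-arc u v u∈R (core⊆ m u u∈Y) v∈Q (core⊆ m v v∈Y))
    (+-mono-≤ #S≤j #S≤j)
  le : ∀ v → bit (Q v ∧ X v) + bit (core m v) ≤ bit (Q v ∧ core m v) + bit (X v)
  le v with Q v | X v | core m v | core⊆ m v
  ... | _     | false | true  | h = ⊥-elim (h tt)
  ... | true  | true  | true  | _ = ≤-refl
  ... | true  | true  | false | _ = ≤-refl
  ... | true  | false | false | _ = z≤n
  ... | false | true  | true  | _ = ≤-refl
  ... | false | _     | false | _ = z≤n
  -- Subtraction-free form of the fact that `Q` contains at most as many vertices of `X` outside the
  -- core as there are in all.
  sum-+-≤ : # (Q ∩ X) + # (core m) ≤ # (Q ∩ core m) + # X
  sum-+-≤ = begin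
    # (Q ∩ X) + # (core m)                            ≡⟨ sym (∑-distrib-+ (bit ∘ (Q ∩ X)) (bit ∘ core m)) ⟩
    ∑[ v < n ] (bit (Q v ∧ X v) + bit (core m v))     ≤⟨ sum-mono le ⟩
    ∑[ v < n ] (bit (Q v ∧ core m v) + bit (X v))     ≡⟨ ∑-distrib-+ (bit ∘ (Q ∩ core m)) (bit ∘ X) ⟩
    # (Q ∩ core m) + # X                              ∎

-- Sets closed under reachability

-- Saturation of `R` along arcs with head in `Z`. The invariant `P` travels along, so that
-- membership in the Boolean result can yield a walk. Every round adds a vertex, and no set exceeds
-- `n`.
closure : ∀ {n} m (G : ArcSet n) (Z : VertexSet n) (P : Fin n → Set) →
  (∀ u v → T (Z v) → T (G u v) → P u → P v) →
  ∀ R → n < m + # R → (∀ v → T (R v) → P v) →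
  ∃ λ R′ → R ⊆ R′ × (∀ v → T (R′ v) → P v) ×
           (∀ u v → T (R′ u) → T (Z v) → T (G u v) → T (R′ v))
closure zero G Z P step R n<#R R-P = contradiction (#≤n R) (<⇒≱ n<#R)
closure (suc m) G Z P step R n<m+#R R-P
  with any? (λ u → any? (λ v → T? (R u) ×-dec T? (Z v) ×-dec T? (G u v) ×-dec ¬? (T? (R v))))
... | no closed = R , (λ _ → id) , R-P , λ u v u∈R v∈Z u→v → in-R u v u∈R v∈Z u→v
  where
  in-R : ∀ u v → T (R u) → T (Z v) → T (G u v) → T (R v)
  in-R u v u∈R v∈Z u→v with T? (R v)
  ... | yes v∈R = v∈R
  ... | no  v∉R = contradiction (u , v , u∈R , v∈Z , u→v , v∉R) closed
... | yes (u , v , u∈R , v∈Z , u→v , v∉R) =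
  let R′ , R⊆ , rest = closure m G Z P step (insert v R)
        (<-≤-trans n<m+#R (≤-trans (≤-reflexive (sym (+-suc m (# R))))
          (+-monoʳ-≤ m (#-mono-< (insert-⊇ v R) v v∉R (∈-insert v R)))))
        (λ w w∈ → insert-P w (insert⁻ v R w w∈))
  in  R′ , (λ w → R⊆ w ∘ insert-⊇ v R w) , rest
  where
  insert-P : ∀ w → w ≡ v ⊎ T (R w) → P w
  insert-P w (inj₁ refl) = step u v v∈Z u→v (R-P u u∈R)
  insert-P w (inj₂ w∈R)  = R-P w w∈R

-- Translation between digraphs and Boolean arc sets

T-does : ∀ {P : Set} (d : Dec P) → T (does d) → P
T-does (yes p) _ = p

does-T : ∀ {P : Set} (d : Dec P) → P → T (does d)
does-T (yes _) _ = tt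
does-T (no ¬p) p = ¬p p

arcSet : ∀ {n} → Digraph n → ArcSet n
arcSet D u v = does (arc? D u v)

∣∣≡# : ∀ {n} (S : Subset n) → ∣ S ∣ ≡ # (Vec.lookup S)
∣∣≡# []          = refl
∣∣≡# (true  ∷ S) = cong suc (∣∣≡# S)
∣∣≡# (false ∷ S) = ∣∣≡# S

∈∁⇒∉ : ∀ {n} (S : Subset n) {v} → v ∈ˢ ∁ S → ¬ T (Vec.lookup S v)
∈∁⇒∉ S {v} v∈∁S v∈S = x∈∁p⇒x∉p v∈∁S (lookup⇒[]= v S (to T-≡ v∈S))

∉⇒∈∁ : ∀ {n} (S : Subset n) {v} → ¬ T (Vec.lookup S v) → v ∈ˢ ∁ S
∉⇒∈∁ S v∉S = x∉p⇒x∈∁p (v∉S ∘ from T-≡ ∘ []=⇒lookup)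

star-crosses : ∀ {V : Set} {R : V → V → Set} {P : V → Set} → Decidable P → ∀ {x y} →
  Star R x y → ¬ P x → P y → ∃₂ λ u v → R u v × ¬ P u × P v
star-crosses P? ε         ¬Px Py = contradiction Py ¬Px
star-crosses P? (_◅_ {x} {z} r rs) ¬Px Py with P? z
... | yes Pz = x , z , r , ¬Px , Pz
... | no ¬Pz = star-crosses P? rs ¬Pz Py

strongly-connected⇒crossing : ∀ {n k} (D : Digraph n) → (Strongly k -connected) D → Crossing k (arcSet D)
strongly-connected⇒crossing {n} {k} D (_ , strong) S Q x y #S<k x∉S y∉S x∉Q y∈Q
  with star-crosses (λ v → T? (Q (proj₁ v)))
         (strong s small (x , ∈∁s x∉S) (y , ∈∁s y∉S)) x∉Q y∈Q
  where
  s : Subset n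
  s = Vec.tabulate S
  small : ∣ s ∣ < k
  small = subst (_< k) (sym (trans (∣∣≡# s) (sum-cong-≗ λ v → cong bit (lookup∘tabulate S v)))) #S<k
  ∈∁s : ∀ {v} → ¬ T (S v) → v ∈ˢ ∁ s
  ∈∁s {v} v∉S = ∉⇒∈∁ s (v∉S ∘ subst T (lookup∘tabulate S v))
... | (u , u∈) , (v , v∈) , u→v , u∉Q , v∈Q =
  u , v , does-T (arc? D u v) u→v , ∉S u u∈ , ∉S v v∈ , u∉Q , v∈Q
  where
  ∉S : ∀ w → w ∈ˢ ∁ (Vec.tabulate S) → ¬ T (S w)
  ∉S w w∈ = ∈∁⇒∉ _ w∈ ∘ subst T (sym (lookup∘tabulate S w))

tournament-arcSet : ∀ {n} (D : Digraph n) → IsTournament D → Tournament (arcSet D)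
tournament-arcSet D compare = record
  { irrefl = λ v t → loopless D v (T-does (arc? D v v) t)
  ; asym   = λ u v t t′ → asymmetric u v (T-does (arc? D u v) t) (T-does (arc? D v u) t′)
  ; total  = semicomplete }
  where
  asymmetric : ∀ u v → Arc D u v → ¬ Arc D v u
  asymmetric u v u→v v→u with compare u v
  ... | tri< _   _ v↛u = v↛u v→u
  ... | tri≈ u↛v _ _   = u↛v u→v
  ... | tri> u↛v _ _   = u↛v u→v
  semicomplete : ∀ u v → u ≢ v → T (arcSet D u v) ⊎ T (arcSet D v u)
  semicomplete u v u≢v with compare u v
  ... | tri< u→v _   _   = inj₁ (does-T (arc? D u v) u→v)
  ... | tri≈ _   u≡v _   = contradiction u≡v u≢v
  ... | tri> _   _   v→u = inj₂ (does-T (arc? D v u) v→u)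

length-filter-map : ∀ {A B : Set} {P : B → Set} (P? : Decidable P) (f : A → B) {n} (g : Fin n → A) →
  length (filter P? (List.map f (List.tabulate g))) ≡ ∑[ i < n ] bit (does (P? (f (g i))))
length-filter-map P? f {zero}  g = refl
length-filter-map P? f {suc n} g with does (P? (f (g zero)))
... | true  = cong suc (length-filter-map P? f (g ∘ suc))
... | false = length-filter-map P? f (g ∘ suc)

length-E : ∀ {n} (D : Digraph n) → length (E D) ≡ arcs (arcSet D)
length-E {n} D = rows id
  where
  P? : Decidable (uncurry (Arc D))
  P? (u , v) = arc? D u v
  -- The rows are generalised to an arbitrary tabulated list, while the columns stay fixed, so that
  -- induction on the number of rows applies.
  rows : ∀ {m} (g : Fin m → Fin n) →
    length (filter P? (cartesianProduct (List.tabulate g) (allFin n))) ≡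
    ∑[ i < m ] ∑[ v < n ] bit (arcSet D (g i) v)
  rows {zero}  g = refl
  rows {suc m} g = trans
    (cong length (filter-++ P? (List.map (g zero ,_) (allFin n)) _))
    (trans (length-++ (filter P? (List.map (g zero ,_) (allFin n))))
      (cong₂ _+_ (length-filter-map P? (g zero ,_) id) (rows (g ∘ suc))))

-- Arithmetic of the arc bound

2*[1+p]C2 : ∀ p → suc p C 2 + suc p C 2 ≡ suc p * p
2*[1+p]C2 zero    = refl
2*[1+p]C2 (suc p) = begin
  suc (suc p) C 2 + suc (suc p) C 2                     ≡⟨ cong (λ c → c + c) pascal ⟩
  (suc p + suc p C 2) + (suc p + suc p C 2)
    ≡⟨ solve 2 (λ p c → (p :+ c) :+ (p :+ c) := (p :+ p) :+ (c :+ c)) refl (suc p) (suc p C 2) ⟩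
  (suc p + suc p) + (suc p C 2 + suc p C 2)             ≡⟨ cong ((suc p + suc p) +_) (2*[1+p]C2 p) ⟩
  (suc p + suc p) + suc p * p
    ≡⟨ solve 1 (λ p → (con 1 :+ p :+ (con 1 :+ p)) :+ (con 1 :+ p) :* p :=
                      (con 2 :+ p) :* (con 1 :+ p)) refl p ⟩
  suc (suc p) * suc p                                   ∎
  where
  open ≡-Reasoning
  open +-*-Solver
  pascal : suc (suc p) C 2 ≡ suc p + suc p C 2
  pascal = trans (sym (nCk+nC[k+1]≡[n+1]C[k+1] (suc p) 1)) (cong (_+ suc p C 2) (nC1≡n (suc p)))

double-cancel-≤ : ∀ {a b} → a + a ≤ b + b → a ≤ b
double-cancel-≤ {a} {b} h = ≮⇒≥ λ b<a → <⇒≱ (+-mono-< b<a b<a) h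

bound : ℕ → ℕ → ℕ
bound j n = (5 * suc j ∸ 2) * n + (5 * suc j) C 2

-- Doubling clears the binomial coefficient and `k = j + 1` the truncated subtraction, which leaves
-- a polynomial.
2*bound : ∀ j n → bound j n + bound j n ≡ (10 * j + 6) * n + (25 * j * j + 45 * j + 20)
2*bound j n = begin
  bound j n + bound j n
    ≡⟨ cong (λ c → c + c) (cong₂ _+_
         (cong (_* n) (trans (cong (_∸ 2) five) (m+n∸m≡n 2 (3 + 5 * j))))
         (cong (_C 2) five)) ⟩
  ((3 + 5 * j) * n + c) + ((3 + 5 * j) * n + c)
    ≡⟨ solve 2 (λ x c → (x :+ c) :+ (x :+ c) := (x :+ x) :+ (c :+ c)) refl ((3 + 5 * j) * n) c ⟩
  ((3 + 5 * j) * n + (3 + 5 * j) * n) + (c + c)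
    ≡⟨ cong (((3 + 5 * j) * n + (3 + 5 * j) * n) +_) (2*[1+p]C2 (4 + 5 * j)) ⟩
  ((3 + 5 * j) * n + (3 + 5 * j) * n) + (5 + 5 * j) * (4 + 5 * j)
    ≡⟨ solve 2 (λ j n → let q = con 3 :+ con 5 :* j in
         (q :* n :+ q :* n) :+ (con 5 :+ con 5 :* j) :* (con 4 :+ con 5 :* j) :=
         (con 10 :* j :+ con 6) :* n :+ (con 25 :* j :* j :+ con 45 :* j :+ con 20)) refl j n ⟩
  (10 * j + 6) * n + (25 * j * j + 45 * j + 20) ∎
  where
  open ≡-Reasoning
  open +-*-Solver
  five : 5 * suc j ≡ 5 + 5 * j
  five = *-suc 5 j
  c : ℕ
  c = (5 + 5 * j) C 2

-- The linear term alone suffices: twice the arc count is at most `n * n`, hence at most `7jn`.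
bound-small : ∀ j n w → n * n ≡ n + (w + w) → n ≤ 7 * j → w ≤ bound j n
bound-small j n w eq n≤7j = double-cancel-≤ (begin
  w + w             ≤⟨ m≤n+m (w + w) n ⟩
  n + (w + w)       ≡⟨ sym eq ⟩
  n * n             ≤⟨ *-monoˡ-≤ n n≤7j ⟩
  7 * j * n         ≤⟨ *-monoˡ-≤ n (≤-trans (*-monoˡ-≤ j (m≤m+n 7 3)) (m≤m+n (10 * j) 6)) ⟩
  (10 * j + 6) * n  ≤⟨ m≤m+n _ _ ⟩
  (10 * j + 6) * n + (25 * j * j + 45 * j + 20) ≡⟨ sym (2*bound j n) ⟩
  bound j n + bound j n ∎)
  where open ≤-Reasoning

bound-large : ∀ j n w → (7 * j + 1) * (7 * j + 1) ≡ 7 * j + 1 + (w + w) → 7 * j + 1 ≤ n →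
              n * suc j + (n * suc j + w) ≤ bound j n
bound-large j n w eq m≤n = double-cancel-≤ (+-cancelˡ-≤ (7 * j + 1) _ _ (begin
  m + (n * suc j + (n * suc j + w) + (n * suc j + (n * suc j + w)))
    ≡⟨ solve 4 (λ m n j w → let s = n :* (con 1 :+ j) in
         m :+ (s :+ (s :+ w) :+ (s :+ (s :+ w))) := (con 4 :+ con 4 :* j) :* n :+ (m :+ (w :+ w))) refl m n j w ⟩
  (4 + 4 * j) * n + (m + (w + w))
    ≡⟨ cong ((4 + 4 * j) * n +_) (sym eq) ⟩
  (4 + 4 * j) * n + m * m
    -- The amount added is the exact slack at `n = m`. The factor `6j + 2` produced next is what
    -- `10j + 6` leaves after the two linkages have used `4 + 4j`; replacing `m` by `n` there only
    -- increases the value.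
    ≤⟨ +-monoʳ-≤ ((4 + 4 * j) * n) (m≤m+n (m * m) (18 * j * j + 58 * j + 22)) ⟩
  (4 + 4 * j) * n + (m * m + (18 * j * j + 58 * j + 22))
    ≡⟨ cong ((4 + 4 * j) * n +_) (solve 1 (λ j → let m = con 7 :* j :+ con 1 in
         m :* m :+ (con 18 :* j :* j :+ con 58 :* j :+ con 22) :=
         (con 6 :* j :+ con 2) :* m :+ (m :+ (con 25 :* j :* j :+ con 45 :* j :+ con 20))) refl j) ⟩
  (4 + 4 * j) * n + ((6 * j + 2) * m + (m + (25 * j * j + 45 * j + 20)))
    ≤⟨ +-monoʳ-≤ ((4 + 4 * j) * n) (+-monoˡ-≤ _ (*-monoʳ-≤ (6 * j + 2) m≤n)) ⟩
  (4 + 4 * j) * n + ((6 * j + 2) * n + (m + (25 * j * j + 45 * j + 20)))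
    ≡⟨ solve 3 (λ j n m → let c = con 25 :* j :* j :+ con 45 :* j :+ con 20 in
         (con 4 :+ con 4 :* j) :* n :+ ((con 6 :* j :+ con 2) :* n :+ (m :+ c)) :=
         m :+ ((con 10 :* j :+ con 6) :* n :+ c)) refl j n m ⟩
  m + ((10 * j + 6) * n + (25 * j * j + 45 * j + 20))
    ≡⟨ cong (m +_) (sym (2*bound j n)) ⟩
  m + (bound j n + bound j n) ∎))
  where
  open ≤-Reasoning
  open +-*-Solver
  m : ℕ
  m = 7 * j + 1

-- Cuts of the union of hub and linkages

-- With no arc from `R` to `Q`, the cut with sides `Q` and `R` has size at most |S|, which is less
-- than `k`. A nonempty `Q` that avoided `B` would violate linkage.
linked⇒meets : ∀ {n k} {B : VertexSet n} {G} → Linked k B G → ∀ R S Q →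
  (∀ v → T (R v) ⊎ T (S v) ⊎ T (Q v)) → # S < k → ∃ (T ∘ Q) →
  (∀ u v → T (R u) → T (Q v) → ¬ T (G u v)) → ∃ λ b → T (B b) × T (Q b)
linked⇒meets {n} {k} {B} {G} linked R S Q cover #S<k (y , y∈Q) no-arc
  with any? (λ b → T? (B b) ×-dec T? (Q b))
... | yes found = found
... | no  none  = contradiction
  (≤-trans (linked Q R y y∈Q λ b b∈B b∈Q → none (b , b∈B , b∈Q)) (sum-mono le))
  (<⇒≱ #S<k)
  where
  open ≤-Reasoning
  boundary⊆S : ∀ u → T (not (Q u) ∧ not (R u)) → T (S u)
  boundary⊆S u u∈ with cover u
  ... | inj₁ u∈R        = contradiction u∈R (T-not⇒¬T (proj₂ (to (T-∧ {not (Q u)}) u∈)))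
  ... | inj₂ (inj₁ u∈S) = u∈S
  ... | inj₂ (inj₂ u∈Q) = contradiction u∈Q (T-not⇒¬T (proj₁ (to T-∧ u∈)))
  le : ∀ u → boundaryAt G Q R u ≤ bit (S u)
  le u = begin
    bit (not (Q u) ∧ not (R u)) + ∑[ v < n ] bit (G u v ∧ R u ∧ Q v)
      ≤⟨ +-mono-≤ (bit-mono _ _ (boundary⊆S u)) (sum-mono λ v → bit-mono _ false λ t →
           let u→v , t′ = to (T-∧ {G u v}) t ; u∈R , v∈Q = to T-∧ t′ in no-arc u v u∈R v∈Q u→v) ⟩
    bit (S u) + ∑[ v < n ] 0 ≡⟨ cong (bit (S u) +_) (sum-replicate-zero n) ⟩
    bit (S u) + 0            ≡⟨ +-identityʳ _ ⟩
    bit (S u)                ∎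

_∪ᵃ_ : ∀ {n} → ArcSet n → ArcSet n → ArcSet n
(F ∪ᵃ G) u v = F u v ∨ G u v

arcs-∪ : ∀ {n} (F G : ArcSet n) → arcs (F ∪ᵃ G) ≤ arcs F + arcs G
arcs-∪ {n} F G = begin
  arcs (F ∪ᵃ G)
    ≤⟨ sum-mono (λ u → sum-mono λ v → bit-∨ (F u v) (G u v)) ⟩
  ∑[ u < n ] ∑[ v < n ] (bit (F u v) + bit (G u v))
    ≡⟨ sum-cong-≗ (λ u → ∑-distrib-+ (bit ∘ F u) (bit ∘ G u)) ⟩
  ∑[ u < n ] (∑[ v < n ] bit (F u v) + ∑[ v < n ] bit (G u v))
    ≡⟨ ∑-distrib-+ (λ u → ∑[ v < n ] bit (F u v)) _ ⟩
  arcs F + arcs G ∎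
  where
  open ≤-Reasoning
  bit-∨ : ∀ a b → bit (a ∨ b) ≤ bit a + bit b
  bit-∨ true  b = s≤s z≤n
  bit-∨ false b = ≤-refl

indeg≤⇒arcs≤ : ∀ {n} (G : ArcSet n) k → (∀ v → indeg G v ≤ k) → arcs G ≤ n * k
indeg≤⇒arcs≤ G k indeg≤k = subst (_≤ _) (arcs-flip G) (sum≤*bound (indeg G) k indeg≤k)

partition⇒#≤ : ∀ {n} (U R S Q : VertexSet n) → (∀ v → T (R v) ⊎ T (S v) ⊎ T (Q v)) →
               # U ≤ # (R ∩ U) + # S + # (Q ∩ U)
partition⇒#≤ {n} U R S Q cover = begin
  # U
    ≤⟨ sum-mono le ⟩
  ∑[ v < n ] (bit (R v ∧ U v) + bit (S v) + bit (Q v ∧ U v))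
    ≡⟨ ∑-distrib-+ (λ v → bit (R v ∧ U v) + bit (S v)) _ ⟩
  ∑[ v < n ] (bit (R v ∧ U v) + bit (S v)) + # (Q ∩ U)
    ≡⟨ cong (_+ # (Q ∩ U)) (∑-distrib-+ (bit ∘ (R ∩ U)) (bit ∘ S)) ⟩
  # (R ∩ U) + # S + # (Q ∩ U) ∎
  where
  open ≤-Reasoning
  le : ∀ v → bit (U v) ≤ bit (R v ∧ U v) + bit (S v) + bit (Q v ∧ U v)
  le v with U v | R v | S v | Q v | cover v
  ... | false | _     | _     | _     | _ = z≤n
  ... | true  | true  | _     | _     | _ = s≤s z≤n
  ... | true  | false | true  | _     | _ = s≤s z≤n
  ... | true  | false | false | true  | _ = ≤-refl
  ... | true  | false | false | false | inj₁ ()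
  ... | true  | false | false | false | inj₂ (inj₁ ())
  ... | true  | false | false | false | inj₂ (inj₂ ())

-- Everything the connectivity of `H` rests on. `toSources` is kept reversed, since linking all
-- vertices to the sources is linking the sources to all vertices with arcs reversed.
record Skeleton {n} (G : ArcSet n) (j : ℕ) (H : ArcSet n) : Set where
  field
    hub sources sinks    : VertexSet n
    hub-large            : 7 * j < # hub
    sources-max          : ∀ a → T (sources a) → NearlyMaximal G hub j a
    sinks-max            : ∀ b → T (sinks b) → NearlyMaximal (flip G) hub j b
    fromSinks toSources  : ArcSet n
    fromSinks-linked     : Linked (suc j) sinks fromSinks
    toSources-linked     : Linked (suc j) sources toSources
    fromSinks⊑           : fromSinks ⊑ H
    toSources⊑           : flip toSources ⊑ H
    hub⊑                 : induced G hub ⊑ H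

-- If no arc led from `R` to `Q`, the linkages would place a source in `R` and a sink in `Q`. The
-- source forces at most `3j` hub vertices into `Q`, the sink at most `3j` into `R`, and `S` holds
-- at most `j`: together `7j`, fewer than the hub has.
skeleton⇒no-cut : ∀ {n} {G H : ArcSet n} {j} → Tournament G → Skeleton G j H → ∀ R S Q →
  (∀ v → T (R v) ⊎ T (S v) ⊎ T (Q v)) → (∀ v → T (R v) → ¬ T (Q v)) → # S ≤ j →
  ∃ (T ∘ R) → ∃ (T ∘ Q) → ¬ (∀ u v → T (R u) → T (Q v) → ¬ T (H u v))
skeleton⇒no-cut {n} {G} {H} {j} t skeleton R S Q cover disjoint #S≤j R≢∅ Q≢∅ no-arc =
  <⇒≱ hub-large (begin
    # hub                           ≤⟨ partition⇒#≤ hub R S Q cover ⟩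
    # (R ∩ hub) + # S + # (Q ∩ hub) ≤⟨ +-mono-≤ (+-mono-≤ few-R #S≤j) few-Q ⟩
    (j + j + j) + j + (j + j + j)   ≡⟨ solve 1 (λ j → (j :+ j :+ j) :+ j :+ (j :+ j :+ j) := con 7 :* j) refl j ⟩
    7 * j                           ∎)
  where
  open ≤-Reasoning
  open +-*-Solver
  open Skeleton skeleton
  cover′ : ∀ v → T (Q v) ⊎ T (S v) ⊎ T (R v)
  cover′ v with cover v
  ... | inj₁ v∈R        = inj₂ (inj₂ v∈R)
  ... | inj₂ (inj₁ v∈S) = inj₂ (inj₁ v∈S)
  ... | inj₂ (inj₂ v∈Q) = inj₁ v∈Q
  no-arc-hub : ∀ u v → T (R u) → T (hub u) → T (Q v) → T (hub v) → ¬ T (G u v)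
  no-arc-hub u v u∈R u∈U v∈Q v∈U u→v =
    no-arc u v u∈R v∈Q (hub⊑ u v (from T-∧ (u∈U , from T-∧ (v∈U , u→v))))
  few-Q : # (Q ∩ hub) ≤ j + j + j
  few-Q with linked⇒meets toSources-linked Q S R cover′ (s≤s #S≤j) R≢∅
               (λ u v u∈Q v∈R v→u → no-arc v u v∈R u∈Q (toSources⊑ v u v→u))
  ... | a , a∈A , a∈R = nearly-maximal⇒few-unreached t (sources-max a a∈A) R S Q #S≤j
        cover disjoint a∈R no-arc-hub
  few-R : # (R ∩ hub) ≤ j + j + j
  few-R with linked⇒meets fromSinks-linked R S Q cover (s≤s #S≤j) Q≢∅
               (λ u v u∈R v∈Q u→v → no-arc u v u∈R v∈Q (fromSinks⊑ u v u→v))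
  ... | b , b∈B , b∈Q = nearly-maximal⇒few-unreached (tournament-flip t) (sinks-max b b∈B) Q S R #S≤j
        cover′ (λ v v∈Q v∈R → disjoint v v∈R v∈Q) b∈Q
        λ u v u∈Q u∈U v∈R v∈U → no-arc-hub v u v∈R v∈U u∈Q u∈U

digraph : ∀ {n} (H : ArcSet n) → (∀ v → ¬ T (H v v)) → Digraph n
digraph H irreflexive = record { Arc = λ u v → T (H u v) ; arc? = λ u v → T? (H u v) ; loopless = irreflexive }

-- The set reached from `x` outside `S` sends no arc to the other remaining vertices; by
-- `skeleton⇒no-cut` none of these exist.
skeleton⇒strongly-connected : ∀ {n} {G H : ArcSet n} {j} → Tournament G → Skeleton G j H → ∀ irreflexive →
  ∀ (S : Subset n) → ∣ S ∣ < suc j → StronglyConnected (digraph H irreflexive ∖ S)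
skeleton⇒strongly-connected {n} {G} {H} {j} t skeleton irreflexive S (s≤s ∣S∣≤j) (x , x∈) (y , y∈)
  -- Fuel `suc n` is enough whatever the size of the starting set.
  with closure (suc n) H (λ v → not (Vec.lookup S v)) Reached step
         (insert x (const false)) (s≤s (m≤m+n n _)) (λ v → start v ∘ insert⁻ x (const false) v)
  where
  Reached : Fin n → Set
  Reached v = Σ[ v∈ ∈ v ∈ˢ ∁ S ] Star (digraph H irreflexive ∖ S) (x , x∈) (v , v∈)
  step : ∀ u v → T (not (Vec.lookup S v)) → T (H u v) → Reached u → Reached v
  step u v v∉S u→v (_ , walk) = ∉⇒∈∁ S (T-not⇒¬T v∉S) , walk ◅◅ (u→v ◅ ε)
  start : ∀ v → v ≡ x ⊎ T false → Reached v
  start _ (inj₁ refl) = x∈ , ε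
... | R , ⊆R , reached , closed with T? (R y)
...   | yes y∈R = let y∈′ , walk = reached y y∈R in
        -- The walk ends at `y` with its own proof of survival; such proofs are unique.
        subst (λ p → Star _ _ (y , p)) ([]=-irrelevant y∈′ y∈) walk
...   | no  y∉R = ⊥-elim (skeleton⇒no-cut t skeleton R (Vec.lookup S) Q cover
        (λ v v∈R v∈Q → T-not⇒¬T (proj₁ (to T-∧ v∈Q)) v∈R)
        (subst (_≤ j) (∣∣≡# S) ∣S∣≤j)
        (x , ⊆R x (∈-insert x _))
        (y , from T-∧ (¬T⇒T-not y∉R , ¬T⇒T-not (∈∁⇒∉ S y∈)))
        λ u v u∈R v∈Q u→v → let v∉R , v∉S = to T-∧ v∈Q in
          T-not⇒¬T v∉R (closed u v u∈R v∉S u→v))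
  where
  Q : VertexSet n
  Q v = not (R v) ∧ not (Vec.lookup S v)
  cover : ∀ v → T (R v) ⊎ T (Vec.lookup S v) ⊎ T (Q v)
  cover v with R v | Vec.lookup S v
  ... | true  | _     = inj₁ tt
  ... | false | true  = inj₂ (inj₁ tt)
  ... | false | false = inj₂ (inj₂ tt)

sparse-skeleton : ∀ {n} {G : ArcSet n} → Tournament G → ∀ j → Crossing (suc j) G →
  ∀ hub → # hub ≡ 7 * j + 1 → ∃ λ H → H ⊑ G × Skeleton G j H × arcs H ≤ bound j n
sparse-skeleton {n} {G} t j crossing hub #hub
  with nearly-maximal G j hub j<#hub | nearly-maximal (flip G) j hub j<#hub
  where
  j<#hub : j < # hub
  j<#hub = subst (j <_) (sym #hub) (≤-trans (s≤s (m≤m+n j _)) (≤-reflexive (+-comm 1 (7 * j))))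
... | A , j<#A , _ , A-max | B , j<#B , _ , B-max
  -- Here `≤-refl` sets the fuel to one more than the number of arcs. Reversing arcs turns the
  -- second indegree bound into an outdegree bound.
  with sparsify (suc j) B _ G ≤-refl (crossing⇒linked crossing j<#B)
     | sparsify (suc j) A _ (flip G) ≤-refl (crossing⇒linked (crossing-flip crossing) j<#A)
... | F , F⊑ , F-linked , F-indeg | F′ , F′⊑ , F′-linked , F′-indeg = H , H⊑ , skeleton , few
  where
  H : ArcSet n
  H = F ∪ᵃ (flip F′ ∪ᵃ induced G hub)
  H⊑ : H ⊑ G
  H⊑ u v u→v with to (T-∨ {F u v}) u→v
  ... | inj₁ f = F⊑ u v f
  ... | inj₂ rest with to (T-∨ {F′ v u}) rest
  ...   | inj₁ f′ = F′⊑ v u f′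
  ...   | inj₂ h  = proj₂ (to (T-∧ {hub v}) (proj₂ (to (T-∧ {hub u}) h)))
  skeleton : Skeleton G j H
  skeleton = record
    { hub = hub ; sources = A ; sinks = B
    ; hub-large = ≤-reflexive (trans (+-comm 1 (7 * j)) (sym #hub))
    ; sources-max = A-max ; sinks-max = B-max
    ; fromSinks = F ; toSources = F′
    ; fromSinks-linked = F-linked ; toSources-linked = F′-linked
    ; fromSinks⊑ = λ u v f → from T-∨ (inj₁ f)
    ; toSources⊑ = λ u v f → from (T-∨ {F u v}) (inj₂ (from T-∨ (inj₁ f)))
    ; hub⊑ = λ u v h → from (T-∨ {F u v}) (inj₂ (from (T-∨ {F′ v u}) (inj₂ h))) }
  few : arcs H ≤ bound j n
  few = begin
    arcs H
      ≤⟨ arcs-∪ F _ ⟩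
    arcs F + arcs (flip F′ ∪ᵃ induced G hub)
      ≤⟨ +-monoʳ-≤ (arcs F) (arcs-∪ (flip F′) _) ⟩
    arcs F + (arcs (flip F′) + arcs (induced G hub))
      ≤⟨ +-mono-≤ (indeg≤⇒arcs≤ F (suc j) F-indeg)
           (+-monoˡ-≤ _ (≤-trans (≤-reflexive (arcs-flip F′)) (indeg≤⇒arcs≤ F′ (suc j) F′-indeg))) ⟩
    n * suc j + (n * suc j + arcs (induced G hub))
      ≤⟨ bound-large j n _ hub-arcs (subst (_≤ n) #hub (#≤n hub)) ⟩
    bound j n ∎
    where
    open ≤-Reasoning
    hub-arcs : (7 * j + 1) * (7 * j + 1) ≡ 7 * j + 1 + (arcs (induced G hub) + arcs (induced G hub))
    hub-arcs = subst (λ m → m * m ≡ m + (arcs (induced G hub) + arcs (induced G hub)))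
                     #hub (arcs-tournament t hub)

theorem4p2 : ∀ (k : ℕ) → 1 ≤ k → ∀ (n : ℕ) (T : Digraph n) →
    IsTournament T → (Strongly k -connected) T →
    Σ[ D ∈ Digraph n ]
    (D IsSpanningSubgraphOf T) × (Strongly k -connected) D ×
    (length (E D) ≤ (5 * k ∸ 2) * n + ((5 * k) C 2))
theorem4p2 (suc j) _ n D₀ compare strong@(k<n , _) with 7 * j + 1 ≤? n
... | yes large =
  -- Any `7j + 1` vertices can serve as hub; the initial ones are taken.
  let t = tournament-arcSet D₀ compare
      H , H⊑ , skeleton , few = sparse-skeleton t j (strongly-connected⇒crossing D₀ strong)
                                  (initial (7 * j + 1)) (#-initial large)
      irreflexive = λ v → irrefl t v ∘ H⊑ v v
  in  digraph H irreflexive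
    , (λ {u} {v} u→v → T-does (arc? D₀ u v) (H⊑ u v u→v))
    , (k<n , skeleton⇒strongly-connected t skeleton irreflexive)
    , ≤-trans (≤-reflexive (length-E (digraph H irreflexive))) few
... | no  small =
  D₀ , id , strong
  , ≤-trans (≤-reflexive (length-E D₀))
      (bound-small j n (arcs (arcSet D₀))
        (subst (λ m → m * m ≡ m + (arcs (arcSet D₀) + arcs (arcSet D₀))) #all
          (arcs-tournament (tournament-arcSet D₀ compare) (const true)))
        (s≤s⁻¹ (subst (n <_) (+-comm (7 * j) 1) (≰⇒> small))))
  where
  #all : # (const {B = Fin n} true) ≡ n
  #all = ≤-antisym (#≤n (const true))
           (subst (_≤ # (const {B = Fin n} true)) (#-initial {n} ≤-refl)
             (#-mono {n} {initial n} {const true} λ _ _ → tt))
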